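{- Let $p$ be a prime, $m\mid n$, $s=p^m-1$, $t=(p^n-1)/(p^m-1)$, and assume $\gcd(s,t)=1$. Let $\alpha$ be a generator of $\mathbb{F}_{p^n}^\times$, $\beta=\alpha^t\in\mathbb{F}_{p^m}^\times$, $\gamma=\alpha^s$, and let $B_{i,j}=\mathrm{tr}_{\mathbb{F}_{p^n}/\mathbb{F}_p}(\beta^i\gamma^j)$ for $(i,j)\in\mathbb{Z}_s\times\mathbb{Z}_t$. For each $j$, consider the column $(B_{i,j})_{0\le i<s}$. Then: (1) if $\mathrm{tr}_{\mathbb{F}_{p^n}/\mathbb{F}_{p^m}}(\gamma^j)=0$, the column is identically zero; (2) if $\mathrm{tr}_{\mathbb{F}_{p^n}/\mathbb{F}_{p^m}}(\gamma^j)=\beta^r\in\mathbb{F}_{p^m}^\times$, then the column equals $\mathsf{DB}_\beta^{[r]}$, i.e. $B_{i,j}=\mathrm{tr}_{\mathbb{F}_{p^m}/\mathbb{F}_p}(\beta^{r+i})$ for all $0\le i<s$.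
   Context: $\mathrm{tr}_{K/F}$ denotes the field trace. $\mathsf{DB}_\beta=(\mathrm{tr}_{\mathbb{F}_{p^m}/\mathbb{F}_p}(\beta^i))_{0\le i<s}$ and for an integer $r$, $\mathsf{DB}_\beta^{[r]}$ is its cyclic shift $(\mathrm{tr}_{\mathbb{F}_{p^m}/\mathbb{F}_p}(\beta^{r+i}))_{0\le i<s}$, indices mod $s$. -}

module Defs where

open import Algebra.Apartness.Bundles using (HeytingField)
open import Algebra.Bundles using (Group; CommutativeRing)
open import Algebra.Definitions using (Invertible)
import Algebra.Definitions.RawMonoid as RawMonoidDefs
open import Algebra.Morphism.Bundles using (RingHomomorphism)
import Algebra.Morphism.Construct.Composition as Composition
import Algebra.Properties.CommutativeMonoid.Sum as MonoidSum
import Algebra.Properties.Group as GroupProperties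
import Algebra.Properties.Ring as RingProperties
import Algebra.Properties.Semiring.Sum as SemiringSum
open import Data.Empty using (⊥-elim)
open import Data.Fin using (Fin; zero; suc; fromℕ<; toℕ; finToFun; funToFin)
open import Data.Fin.Properties using (any?; finToFun-funToFin)
import Data.Fin.Properties as Finₚ
open import Data.Integer using (ℤ; +_; -[1+_])
import Data.Integer as ℤ
open import Data.Integer.DivMod using (n%ℕd<d)
open import Data.List using (List; []; _∷_; allFin)
open import Data.List.Membership.Propositional using (_∈_)
open import Data.List.Membership.Propositional.Properties using (∈-allFin)
open import Data.List.Relation.Unary.Any using (here; there)
open import Data.Nat using (ℕ; zero; suc; _^_; _∸_; NonZero; _<_; z<s)
import Data.Nat as ℕ
import Data.Nat.Properties as ℕₚ
open import Data.Nat.Primality using (Prime; prime⇒nonTrivial)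
open import Data.Product using (∃-syntax; _,_; proj₁; proj₂)
open import Data.Vec.Functional as Vector using (Vector)
open import Function.Bundles using (Inverse)
open import Level using (Level; _⊔_) renaming (suc to lsuc)
open import Relation.Binary.PropositionalEquality as ≡ using (_≡_)
import Relation.Binary.Reasoning.Setoid as SetoidReasoning
open import Relation.Nullary using (Dec; yes; no; ¬_)
open import Relation.Nullary.Decidable using (map′)

private variable
  c ℓ₁ ℓ₂ c′ ℓ₁′ ℓ₂′ c″ ℓ₁″ ℓ₂″ : Level

-- A field whose elements, counted up to _≈_, are exactly q in number.
record FiniteField (c ℓ₁ ℓ₂ : Level) (q : ℕ) : Set (lsuc (c ⊔ ℓ₁ ⊔ ℓ₂)) where
  field
    heytingField : HeytingField c ℓ₁ ℓ₂

  open HeytingField heytingField public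
    hiding (heytingCommutativeRing; apartnessRelation)

  field
    enumeration : Inverse setoid (≡.setoid (Fin q))

  commutativeRing : CommutativeRing c ℓ₁
  commutativeRing = record { isCommutativeRing = isCommutativeRing }

  open CommutativeRing commutativeRing public
    using (ring; rawRing; semiring; +-commutativeMonoid; +-rawMonoid; +-group)

infix 4 _↪_

-- Field embeddings; injectivity is automatic between fields.
record _↪_ {q r} (F : FiniteField c ℓ₁ ℓ₂ q) (K : FiniteField c′ ℓ₁′ ℓ₂′ r) :
           Set (c ⊔ ℓ₁ ⊔ c′ ⊔ ℓ₁′) where
  field
    ringHomomorphism : RingHomomorphism (FiniteField.rawRing F) (FiniteField.rawRing K)

  open RingHomomorphism ringHomomorphism public

infixr 9 _∘↪_

_∘↪_ : ∀ {q r u} {F : FiniteField c ℓ₁ ℓ₂ q} {K : FiniteField c′ ℓ₁′ ℓ₂′ r}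
       {L : FiniteField c″ ℓ₁″ ℓ₂″ u} → K ↪ L → F ↪ K → F ↪ L
_∘↪_ {F = F} {K} {L} κ ι = record
  { ringHomomorphism = Composition.ringHomomorphism
      {M₁ = FiniteField.ring F} {M₂ = FiniteField.ring K} {M₃ = FiniteField.ring L}
      (_↪_.ringHomomorphism ι) (_↪_.ringHomomorphism κ)
  }

module FiniteFieldProperties {q} (F : FiniteField c ℓ₁ ℓ₂ q) where
  open FiniteField F
  private module E = Inverse enumeration
  open RingProperties ring using (-0#≈0#)

  from-to : ∀ x → E.from (E.to x) ≈ x
  from-to x = E.inverseʳ ≡.refl

  infix 4 _≈?_

  _≈?_ : ∀ x y → Dec (x ≈ y)
  x ≈? y = map′ (λ eq → trans (sym (from-to x)) (E.inverseʳ eq)) E.to-cong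
                (E.to x Finₚ.≟ E.to y)

  invertible : ∀ x → ¬ x ≈ 0# → Invertible _≈_ 1# _*_ x
  invertible x x≉0 with any? (λ k → E.from k * x ≈? 1#)
  ... | yes (k , eq) = E.from k , eq , trans (*-comm _ _) eq
  ... | no none = ⊥-elim (x≉0 (proj₁ (tight x 0#) λ x#0 →
    let y , yx≈1 , _ = #⇒invertible x#0 in
    none (E.to y , (begin
      E.from (E.to y) * x  ≈⟨ *-cong (from-to y) (sym (x-0≈x x)) ⟩
      y * (x - 0#)         ≈⟨ yx≈1 ⟩
      1#                   ∎))))
    where
    open SetoidReasoning setoid
    x-0≈x : ∀ x → x - 0# ≈ x
    x-0≈x x = trans (+-congˡ -0#≈0#) (+-identityʳ x)

record Unit {q} (F : FiniteField c ℓ₁ ℓ₂ q) : Set (c ⊔ ℓ₁) where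
  constructor unit
  open FiniteField F
  field
    val        : Carrier
    invertible : Invertible _≈_ 1# _*_ val

open Unit public using (val)

-- The multiplicative group F^×.
units : ∀ {q} → FiniteField c ℓ₁ ℓ₂ q → Group (c ⊔ ℓ₁) ℓ₁
units F = record
  { Carrier = Unit F
  ; _≈_ = λ u v → val u ≈ val v
  ; _∙_ = λ { (unit x (x′ , l , _)) (unit y (y′ , m , _)) →
      let e = begin
            y′ * x′ * (x * y)    ≈⟨ *-assoc _ _ _ ⟩
            y′ * (x′ * (x * y))  ≈⟨ *-congˡ (*-assoc _ _ _) ⟨
            y′ * (x′ * x * y)    ≈⟨ *-congˡ (*-congʳ l) ⟩
            y′ * (1# * y)        ≈⟨ *-congˡ (*-identityˡ y) ⟩
            y′ * y               ≈⟨ m ⟩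
            1#                   ∎
      in unit (x * y) (y′ * x′ , e , trans (*-comm _ _) e) }
  ; ε = unit 1# (1# , *-identityˡ 1# , *-identityˡ 1#)
  ; _⁻¹ = λ { (unit x (x′ , l , r)) → unit x′ (x , r , l) }
  ; isGroup = record
    { isMonoid = record
      { isSemigroup = record
        { isMagma = record
          { isEquivalence = record { refl = refl ; sym = sym ; trans = trans }
          ; ∙-cong = *-cong
          }
        ; assoc = λ u v w → *-assoc (val u) (val v) (val w)
        }
      ; identity = (λ u → *-identityˡ (val u)) , (λ u → *-identityʳ (val u))
      }
    ; inverse = (λ { (unit _ (_ , l , _)) → l }) , (λ { (unit _ (_ , _ , r)) → r })
    ; ⁻¹-cong = λ { {unit x (x′ , l , _)} {unit y (y′ , _ , r)} x≈y → begin
        x′             ≈⟨ *-identityʳ x′ ⟨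
        x′ * 1#        ≈⟨ *-congˡ r ⟨
        x′ * (y * y′)  ≈⟨ *-assoc _ _ _ ⟨
        x′ * y * y′    ≈⟨ *-congʳ (*-congˡ x≈y) ⟨
        x′ * x * y′    ≈⟨ *-congʳ l ⟩
        1# * y′        ≈⟨ *-identityˡ y′ ⟩
        y′             ∎ }
    }
  }
  where
  open FiniteField F
  open SetoidReasoning setoid

module _ {q} {F : FiniteField c ℓ₁ ℓ₂ q} where
  open Group (units F) using (_≈_; _⁻¹; rawMonoid)
  open RawMonoidDefs rawMonoid using () renaming (_×_ to _times_)

  infixr 8 _↑_

  _↑_ : Unit F → ℤ → Unit F
  u ↑ (+ n)    = n times u
  u ↑ -[1+ n ] = suc n times (u ⁻¹)

  IsGenerator : Unit F → Set _
  IsGenerator u = ∀ v → ∃[ k ] (u ↑ k ≈ v)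

module Extension {q r} {F : FiniteField c ℓ₁ ℓ₂ q} {K : FiniteField c′ ℓ₁′ ℓ₂′ r}
                 (ι : F ↪ K) where
  private
    module F = FiniteField F
    module K = FiniteField K
    module Fₚ = FiniteFieldProperties F
    module Kₚ = FiniteFieldProperties K
    module EF = Inverse F.enumeration
    module EK = Inverse K.enumeration
  open _↪_ ι using (⟦_⟧; ⟦⟧-cong; *-homo; -‿homo; 0#-homo; 1#-homo)
  open RawMonoidDefs K.+-rawMonoid using (sum)

  lincomb : ∀ {d} → Vector F.Carrier d → Vector K.Carrier d → K.Carrier
  lincomb a v = sum λ i → ⟦ a i ⟧ K.* v i

  Independent : ∀ {d} → Vector K.Carrier d → Set _
  Independent v = ∀ a → lincomb a v K.≈ K.0# → ∀ i → a i F.≈ F.0#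

  record Basis : Set (c ⊔ ℓ₁ ⊔ c′ ⊔ ℓ₁′) where
    field
      dim         : ℕ
      vec         : Vector K.Carrier dim
      independent : Independent vec
      coord       : K.Carrier → Vector F.Carrier dim
      spanning    : ∀ x → lincomb (coord x) vec K.≈ x

  -- The trace of the F-linear map y ↦ x * y on K: column i of its matrix is
  -- coord (x * vec i).
  traceIn : Basis → K.Carrier → F.Carrier
  traceIn b x = RawMonoidDefs.sum F.+-rawMonoid λ i → coord (x K.* vec i) i
    where open Basis b

  private
    open SetoidReasoning K.setoid
    module Kₛ = MonoidSum K.+-commutativeMonoid
    module Kₘ = SemiringSum K.semiring
    open RingProperties K.ring using (-‿distribˡ-*; -‿distribʳ-*)
    open GroupProperties K.+-group using (inverseˡ-unique)

    InSpan : ∀ {d} → Vector K.Carrier d → K.Carrier → Set _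
    InSpan v x = ∃[ a ] (lincomb a v K.≈ x)

    lincomb-cong : ∀ {d} {a b : Vector F.Carrier d} (v : Vector K.Carrier d) →
                   (∀ i → a i F.≈ b i) → lincomb a v K.≈ lincomb b v
    lincomb-cong v a≈b = Kₛ.sum-cong-≋ λ i → K.*-congʳ (⟦⟧-cong (a≈b i))

    lincomb-scale : ∀ {d} f (a : Vector F.Carrier d) v →
                    lincomb (λ i → f F.* a i) v K.≈ ⟦ f ⟧ K.* lincomb a v
    lincomb-scale {d} f a v = begin
      lincomb (λ i → f F.* a i) v
        ≈⟨ Kₛ.sum-cong-≋ {n = d} (λ i → K.trans (K.*-congʳ (*-homo f (a i))) (K.*-assoc _ _ _)) ⟩
      sum (λ i → ⟦ f ⟧ K.* (⟦ a i ⟧ K.* v i))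
        ≈⟨ Kₘ.*-distribˡ-sum {n = d} ⟦ f ⟧ _ ⟨
      ⟦ f ⟧ K.* lincomb a v ∎

    inSpan? : ∀ {d} (v : Vector K.Carrier d) x → Dec (InSpan v x)
    inSpan? {d} v x =
      map′ (λ (k , eq) → (λ i → EF.from (finToFun k i)) , eq) complete
           (any? λ k → lincomb (λ i → EF.from (finToFun k i)) v Kₚ.≈? x)
      where
      complete : InSpan v x → ∃[ k ] (lincomb (λ i → EF.from (finToFun k i)) v K.≈ x)
      complete (a , eq) = funToFin (λ i → EF.to (a i)) ,
        K.trans (lincomb-cong v λ i → F.trans
                  (F.reflexive (≡.cong EF.from (finToFun-funToFin (λ i → EF.to (a i)) i)))
                  (Fₚ.from-to (a i)))
                eq

    relation⇒inSpan : ∀ {d} {v : Vector K.Carrier d} {x} f a → ¬ f F.≈ F.0# →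
                      ⟦ f ⟧ K.* x K.+ lincomb a v K.≈ K.0# → InSpan v x
    relation⇒inSpan {v = v} {x} f a f≉0 eq =
      let g , gf≈1 , _ = Fₚ.invertible f f≉0 in
      (λ i → F.- g F.* a i) , (begin
        lincomb (λ i → F.- g F.* a i) v   ≈⟨ lincomb-scale (F.- g) a v ⟩
        ⟦ F.- g ⟧ K.* lincomb a v         ≈⟨ K.*-congʳ (-‿homo g) ⟩
        K.- ⟦ g ⟧ K.* lincomb a v         ≈⟨ -‿distribˡ-* _ _ ⟨
        K.- (⟦ g ⟧ K.* lincomb a v)       ≈⟨ -‿distribʳ-* _ _ ⟩
        ⟦ g ⟧ K.* K.- lincomb a v         ≈⟨ K.*-congˡ (inverseˡ-unique _ _ eq) ⟨
        ⟦ g ⟧ K.* (⟦ f ⟧ K.* x)           ≈⟨ K.*-assoc _ _ _ ⟨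
        ⟦ g ⟧ K.* ⟦ f ⟧ K.* x             ≈⟨ K.*-congʳ (*-homo g f) ⟨
        ⟦ g F.* f ⟧ K.* x                 ≈⟨ K.*-congʳ (⟦⟧-cong gf≈1) ⟩
        ⟦ F.1# ⟧ K.* x                    ≈⟨ K.*-congʳ 1#-homo ⟩
        K.1# K.* x                        ≈⟨ K.*-identityˡ x ⟩
        x                                 ∎)

    0*-lincomb : ∀ {d} {v : Vector K.Carrier d} {x} f a → f F.≈ F.0# →
                 ⟦ f ⟧ K.* x K.+ lincomb a v K.≈ lincomb a v
    0*-lincomb {v = v} {x} f a f≈0 = begin
      ⟦ f ⟧ K.* x K.+ lincomb a v  ≈⟨ K.+-congʳ (K.*-congʳ (K.trans (⟦⟧-cong f≈0) 0#-homo)) ⟩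
      K.0# K.* x K.+ lincomb a v   ≈⟨ K.+-congʳ (K.zeroˡ x) ⟩
      K.0# K.+ lincomb a v         ≈⟨ K.+-identityˡ _ ⟩
      lincomb a v                  ∎

    independent-∷ : ∀ {d} {v : Vector K.Carrier d} {x} →
                    Independent v → ¬ InSpan v x → Independent (x Vector.∷ v)
    independent-∷ ind x∉ a eq i with a zero Fₚ.≈? F.0#
    ... | no  a≉0 = ⊥-elim (x∉ (relation⇒inSpan (a zero) (λ j → a (suc j)) a≉0 eq))
    independent-∷ ind x∉ a eq zero    | yes a≈0 = a≈0
    independent-∷ ind x∉ a eq (suc i) | yes a≈0 =
      ind _ (K.trans (K.sym (0*-lincomb (a zero) (λ j → a (suc j)) a≈0)) eq) i

    inSpan-head : ∀ {d} (v : Vector K.Carrier d) x → InSpan (x Vector.∷ v) x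
    inSpan-head {d} v x = (F.1# Vector.∷ λ _ → F.0#) , (begin
      ⟦ F.1# ⟧ K.* x K.+ sum (λ i → ⟦ F.0# ⟧ K.* v i)
        ≈⟨ K.+-cong (K.trans (K.*-congʳ 1#-homo) (K.*-identityˡ x))
                    (Kₛ.sum-cong-≋ {n = d} λ i → K.trans (K.*-congʳ 0#-homo) (K.zeroˡ _)) ⟩
      x K.+ sum {n = d} (λ _ → K.0#)  ≈⟨ K.+-congˡ (Kₛ.sum-replicate-zero d) ⟩
      x K.+ K.0#                      ≈⟨ K.+-identityʳ x ⟩
      x                               ∎)

    inSpan-tail : ∀ {d} {v : Vector K.Carrier d} {x y} → InSpan v y → InSpan (x Vector.∷ v) y
    inSpan-tail (a , eq) = (F.0# Vector.∷ a) , K.trans (0*-lincomb F.0# a F.refl) eq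

    record Reduced (ks : List (Fin r)) : Set (c ⊔ ℓ₁ ⊔ c′ ⊔ ℓ₁′) where
      field
        dim   : ℕ
        vec   : Vector K.Carrier dim
        indep : Independent vec
        spans : ∀ {k} → k ∈ ks → InSpan vec (EK.from k)

    reduce : ∀ ks → Reduced ks
    reduce [] = record { dim = 0 ; vec = λ () ; indep = λ _ _ () ; spans = λ () }
    reduce (k ∷ ks) with reduce ks
    ... | record { vec = v ; indep = ind ; spans = sp } with inSpan? v (EK.from k)
    ... | yes k∈ = record
      { dim = _ ; vec = v ; indep = ind ; spans = λ { (here ≡.refl) → k∈ ; (there k′∈) → sp k′∈ } }
    ... | no  k∉ = record
      { dim = _ ; vec = EK.from k Vector.∷ v
      ; indep = independent-∷ ind k∉
      ; spans = λ { (here ≡.refl) → inSpan-head v _ ; (there k′∈) → inSpan-tail (sp k′∈) }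
      }

  abstract
    basis : Basis
    basis = record
      { dim = R.dim
      ; vec = R.vec
      ; independent = R.indep
      ; coord = λ x → proj₁ (R.spans (∈-allFin (EK.to x)))
      ; spanning = λ x → K.trans (proj₂ (R.spans (∈-allFin (EK.to x)))) (Kₚ.from-to x)
      }
      where module R = Reduced (reduce (allFin r))

  -- Any other basis gives the same value, so the choice is immaterial.
  tr : K.Carrier → F.Carrier
  tr = traceIn basis

open Extension public using (tr)

p^m∸1-nonZero : ∀ {p} → Prime p → ∀ m .{{_ : NonZero m}} → NonZero (p ^ m ∸ 1)
p^m∸1-nonZero {p} pr (suc m) =
  ℕ.>-nonZero (ℕₚ.m<n⇒0<n∸m (ℕₚ.<-≤-trans 1<p (ℕₚ.m≤m*n p (p ^ m) {{p^m≢0}})))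
  where
  1<p : 1 < p
  1<p = ℕ.nonTrivial⇒n>1 p {{prime⇒nonTrivial pr}}
  p^m≢0 : NonZero (p ^ m)
  p^m≢0 = ℕₚ.m^n≢0 p m {{ℕ.>-nonZero (ℕₚ.<-trans z<s 1<p)}}

module _ {a} {A : Set a} where
  -- v ⟨ r ⟩ has i-th entry v (r + i), the index being taken mod s.
  cyclicShift : ∀ {s} .{{_ : NonZero s}} → ℤ → Vector A s → Vector A s
  cyclicShift {s} r v i = v (fromℕ< (n%ℕd<d (r ℤ.+ + toℕ i) s))

-- The sequence (tr (βⁱ)) for 0 ≤ i < s.
DB : ∀ {q r} {F : FiniteField c ℓ₁ ℓ₂ q} {K : FiniteField c′ ℓ₁′ ℓ₂′ r} →
     F ↪ K → ∀ s → Unit K → Vector (FiniteField.Carrier F) s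
DB ι s β i = tr ι (val (β ↑ + toℕ i))

{-# OPTIONS --safe #-}
-- The trace is transitive, tr_{pⁿ/p} = tr_{pᵐ/p} ∘ tr_{pⁿ/pᵐ}, and tr_{pⁿ/pᵐ} is linear over
-- the middle field, so B i j = tr_{pᵐ/p} (βⁱ · tr_{pⁿ/pᵐ} (γʲ)).  The exponent of β may then be
-- reduced mod s because every unit of a field with q elements has order dividing q - 1.
module Submission where

open import Algebra.Bundles using (AbelianGroup; CommutativeRing; Group)
import Algebra.Morphism.Construct.Identity as Identity
import Algebra.Properties.AbelianGroup as AbelianGroupProperties
import Algebra.Properties.CommutativeMonoid.Mult as CommutativeMonoidMult
import Algebra.Properties.CommutativeMonoid.Sum as CommutativeMonoidSum
import Algebra.Properties.CommutativeSemigroup as CommutativeSemigroupProperties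
import Algebra.Properties.Group as GroupProperties
import Algebra.Properties.Semiring.Sum as SemiringSum
open import Data.Empty using (⊥-elim)
open import Data.Fin using (Fin; toℕ; punchIn)
open import Data.Fin.Permutation using (Permutation′; permutation; _⟨$⟩ʳ_)
open import Data.Fin.Properties using (punchInᵢ≢i; toℕ-fromℕ<)
open import Data.Integer using (ℤ; +_; -[1+_]; _+_; _*_; -_; _⊖_)
open import Data.Integer.DivMod using (n%ℕd<d; _%ℕ_; _/ℕ_; a≡a%ℕn+[a/ℕn]*n)
import Data.Integer.Properties as ℤₚ
open import Data.Nat using (ℕ; zero; suc; NonZero; _^_; _∸_; _/_)
import Data.Nat as ℕ
import Data.Nat.Properties as ℕₚ
open import Data.Nat.Divisibility using (_∣_)
open import Data.Nat.GCD using (gcd)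
open import Data.Nat.Primality using (Prime)
open import Data.Product using (_×_; _,_)
open import Data.Vec.Functional using (Vector; removeAt)
open import Function.Bundles using (Inverse)
open import Level using (Level; _⊔_)
open import Relation.Binary.PropositionalEquality as ≡ using (_≡_)
import Relation.Binary.Reasoning.Setoid as SetoidReasoning
open import Relation.Nullary using (yes; no; ¬_)
open import Defs

private variable
  c ℓ₁ ℓ₂ c′ ℓ₁′ ℓ₂′ c″ ℓ₁″ ℓ₂″ c‴ ℓ₁‴ ℓ₂‴ : Level

-- Powers of units

-- Commutativity allows powers of `u` and `u ⁻¹` to be interleaved in `↑-⊖`, and the product over
-- all units to be permuted in `times-exponent`.
unitsAbelian : ∀ {q} → FiniteField c ℓ₁ ℓ₂ q → AbelianGroup (c ⊔ ℓ₁) ℓ₁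
unitsAbelian F = record
  { isAbelianGroup = record
    { isGroup = U.isGroup
    ; comm = λ u v → FiniteField.*-comm F (val u) (val v)
    }
  }
  where module U = Group (units F)

module UnitProperties {q} (F : FiniteField c ℓ₁ ℓ₂ q) where
  open AbelianGroup (unitsAbelian F)
  open CommutativeMonoidMult commutativeMonoid
    using (×-homo-+; ×-assocˡ; ×-congʳ) renaming (_×_ to _times_)
  open CommutativeSemigroupProperties commutativeSemigroup using (interchange)
  open SetoidReasoning setoid

  -- The split on `n` is there because `- (+ n)` reduces only on a constructor. Equality of units
  -- unfolds to equality of `val`, which does not determine the units, so implicit arguments are
  -- given explicitly here and below.
  ↑-neg : ∀ u n → u ↑ - (+ n) ≈ n times (u ⁻¹)
  ↑-neg u zero    = refl {ε}
  ↑-neg u (suc n) = refl {suc n times (u ⁻¹)}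

  -- Integers of opposite sign add by `_⊖_`, so this is the mixed case of `↑-homo-+`. The induction
  -- lowers both exponents at once; the pair `u ∙ u ⁻¹`, inserted as `ε`, restores the two lost
  -- factors.
  ↑-⊖ : ∀ u m n → u ↑ (m ⊖ n) ≈ m times u ∙ n times (u ⁻¹)
  ↑-⊖ u zero    zero    = sym {ε ∙ ε} {ε} (identityˡ ε)
  ↑-⊖ u zero    (suc n) =
    sym {ε ∙ suc n times (u ⁻¹)} {suc n times (u ⁻¹)} (identityˡ (suc n times (u ⁻¹)))
  ↑-⊖ u (suc m) zero    = sym {suc m times u ∙ ε} {suc m times u} (identityʳ (suc m times u))
  ↑-⊖ u (suc m) (suc n) = begin
    u ↑ (suc m ⊖ suc n)                          ≡⟨ ≡.cong (u ↑_) (ℤₚ.[1+m]⊖[1+n]≡m⊖n m n) ⟩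
    u ↑ (m ⊖ n)                                  ≈⟨ ↑-⊖ u m n ⟩
    m times u ∙ n times (u ⁻¹)                   ≈⟨ identityˡ (m times u ∙ n times (u ⁻¹)) ⟨
    ε ∙ (m times u ∙ n times (u ⁻¹))
      ≈⟨ ∙-congʳ {m times u ∙ n times (u ⁻¹)} {u ∙ u ⁻¹} {ε} (inverseʳ u) ⟨
    (u ∙ u ⁻¹) ∙ (m times u ∙ n times (u ⁻¹))
      ≈⟨ interchange u (u ⁻¹) (m times u) (n times (u ⁻¹)) ⟩
    suc m times u ∙ suc n times (u ⁻¹)           ∎

  ↑-homo-+ : ∀ u i j → u ↑ (i + j) ≈ u ↑ i ∙ u ↑ j
  ↑-homo-+ u (+ m)    (+ n)    = ×-homo-+ u m n
  ↑-homo-+ u (+ m)    -[1+ n ] = ↑-⊖ u m (suc n)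
  ↑-homo-+ u -[1+ m ] (+ n)    = begin
    u ↑ (n ⊖ suc m)                      ≈⟨ ↑-⊖ u n (suc m) ⟩
    n times u ∙ suc m times (u ⁻¹)       ≈⟨ comm (n times u) (suc m times (u ⁻¹)) ⟩
    suc m times (u ⁻¹) ∙ n times u       ∎
  ↑-homo-+ u -[1+ m ] -[1+ n ] = begin
    suc (suc (m ℕ.+ n)) times (u ⁻¹)     ≡⟨ ≡.cong (λ k → suc k times (u ⁻¹)) (ℕₚ.+-suc m n) ⟨
    (suc m ℕ.+ suc n) times (u ⁻¹)       ≈⟨ ×-homo-+ (u ⁻¹) (suc m) (suc n) ⟩
    suc m times (u ⁻¹) ∙ suc n times (u ⁻¹)  ∎

  ε-times : ∀ n → n times ε ≈ ε
  ε-times zero    = refl {ε}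
  ε-times (suc n) = trans {ε ∙ n times ε} {n times ε} {ε} (identityˡ (n times ε)) (ε-times n)

  module _ (s : ℕ) (exponent : ∀ u → s times u ≈ ε) where

    times-multiple : ∀ u n → (n ℕ.* s) times u ≈ ε
    times-multiple u n = begin
      (n ℕ.* s) times u  ≈⟨ ×-assocˡ u n s ⟨
      n times (s times u) ≈⟨ ×-congʳ n {s times u} {ε} (exponent u) ⟩
      n times ε           ≈⟨ ε-times n ⟩
      ε                   ∎

    ↑-multiple : ∀ u k → u ↑ (k * + s) ≈ ε
    ↑-multiple u (+ n)    = begin
      u ↑ (+ n * + s)     ≡⟨ ≡.cong (u ↑_) (ℤₚ.pos-* n s) ⟨
      (n ℕ.* s) times u   ≈⟨ times-multiple u n ⟩
      ε                   ∎
    ↑-multiple u -[1+ n ] = begin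
      u ↑ (-[1+ n ] * + s)          ≡⟨ ≡.cong (u ↑_) (ℤₚ.neg-distribˡ-* (+ suc n) (+ s)) ⟨
      u ↑ - (+ suc n * + s)         ≡⟨ ≡.cong (λ k → u ↑ - k) (ℤₚ.pos-* (suc n) s) ⟨
      u ↑ - (+ (suc n ℕ.* s))       ≈⟨ ↑-neg u (suc n ℕ.* s) ⟩
      (suc n ℕ.* s) times (u ⁻¹)    ≈⟨ times-multiple (u ⁻¹) (suc n) ⟩
      ε                             ∎

    -- An exponent differs from its remainder by a multiple of `s`, which contributes only `ε`. This
    -- relates the reduced index of `cyclicShift` to an integer exponent.
    ↑-%ℕ : .{{_ : NonZero s}} → ∀ u k → u ↑ (+ (k %ℕ s)) ≈ u ↑ k
    ↑-%ℕ u k = begin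
      u ↑ (+ r)                        ≈⟨ identityʳ (u ↑ (+ r)) ⟨
      u ↑ (+ r) ∙ ε
        ≈⟨ ∙-congˡ {u ↑ (+ r)} {u ↑ (k′ * + s)} {ε} (↑-multiple u k′) ⟨
      u ↑ (+ r) ∙ u ↑ (k′ * + s)       ≈⟨ ↑-homo-+ u (+ r) (k′ * + s) ⟨
      u ↑ (+ r + k′ * + s)             ≡⟨ ≡.cong (u ↑_) (a≡a%ℕn+[a/ℕn]*n k s) ⟨
      u ↑ k                            ∎
      where
      r  = k %ℕ s
      k′ = k /ℕ s

-- Exponent of the multiplicative group

module _ {q} (F : FiniteField c ℓ₁ ℓ₂ (suc q)) where
  open AbelianGroup (unitsAbelian F)
  open CommutativeMonoidMult commutativeMonoid using () renaming (_×_ to _times_)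
  open CommutativeMonoidSum commutativeMonoid
    using (sum; sum-cong-≋; sum-replicate; sum-remove; sum-permute; ∑-distrib-+)
  open AbelianGroupProperties (unitsAbelian F) using (identityˡ-unique)
  private
    module F = FiniteField F
    module E = Inverse F.enumeration
  open FiniteFieldProperties F using (_≈?_; from-to; invertible)

  -- Multiplication by u permutes the enumerated elements.  In the product of all of them, with 0
  -- replaced by ε, it contributes u at every index but that of 0.
  times-exponent : ∀ u → q times u ≈ ε
  times-exponent u@(unit x (x⁻¹ , x⁻¹x≈1 , xx⁻¹≈1)) = begin
    -- `sum` and `times` are additive names for product and power in the group of units.
    q times u                               ≈⟨ sum-replicate q ⟨
    sum {q} (λ _ → u)
      ≈⟨ sum-cong-≋ {x = removeAt factor k₀} {y = λ _ → u} (λ j → factorAt-≉0 _ (punchIn≉0 j)) ⟨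
    sum (removeAt factor k₀)                ≈⟨ identityˡ (sum (removeAt factor k₀)) ⟨
    ε ∙ sum (removeAt factor k₀)
      ≈⟨ ∙-congʳ {sum (removeAt factor k₀)} {factor k₀} {ε} (factorAt-≈0 _ (from-to F.0#)) ⟨
    factor k₀ ∙ sum (removeAt factor k₀)    ≈⟨ sum-remove {i = k₀} factor ⟨
    -- Multiplying by `sum factor` fixes the product of all units; in a group this forces it to be
    -- `ε`.
    sum factor
      ≈⟨ identityˡ-unique (sum factor) (sum element) product-invariant ⟩
    ε                                       ∎
    where
    open SetoidReasoning setoid

    k₀ : Fin (suc q)
    k₀ = E.to F.0#

    factorAt elementAt : F.Carrier → Carrier
    factorAt y with y ≈? F.0#
    ... | yes _ = ε
    ... | no  _ = u
    elementAt y with y ≈? F.0#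
    ... | yes _   = ε
    ... | no  y≉0 = unit y (invertible y y≉0)

    factor element : Vector Carrier (suc q)
    factor  k = factorAt (E.from k)
    element k = elementAt (E.from k)

    factorAt-≈0 : ∀ y → y F.≈ F.0# → factorAt y ≈ ε
    factorAt-≈0 y y≈0 with y ≈? F.0#
    ... | yes _   = F.refl
    ... | no  y≉0 = ⊥-elim (y≉0 y≈0)

    factorAt-≉0 : ∀ y → ¬ y F.≈ F.0# → factorAt y ≈ u
    factorAt-≉0 y y≉0 with y ≈? F.0#
    ... | yes y≈0 = ⊥-elim (y≉0 y≈0)
    ... | no  _   = F.refl

    punchIn≉0 : ∀ j → ¬ E.from (punchIn k₀ j) F.≈ F.0#
    punchIn≉0 j eq = punchInᵢ≢i k₀ j (≡.sym (E.inverseˡ (F.sym eq)))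

    cancel : ∀ {a b} → a F.* b F.≈ F.1# → ∀ y → a F.* (b F.* y) F.≈ y
    cancel ab≈1 y = F.trans (F.sym (F.*-assoc _ _ _)) (F.trans (F.*-congʳ ab≈1) (F.*-identityˡ y))

    π : Permutation′ (suc q)
    π = permutation (λ k → E.to (x F.* E.from k)) (λ k → E.to (x⁻¹ F.* E.from k))
          (λ k → E.inverseˡ (F.trans (F.*-congˡ (from-to _)) (cancel xx⁻¹≈1 _)))
          (λ k → E.inverseˡ (F.trans (F.*-congˡ (from-to _)) (cancel x⁻¹x≈1 _)))

    -- Since `x` is invertible, `y` and `z` vanish together, which excludes the mixed cases. A
    -- separate `z` is needed because the element enumerated at the permuted index is known to be
    -- `x F.* y` only up to `≈`.
    elementAt-* : ∀ y z → z F.≈ x F.* y → elementAt z ≈ factorAt y ∙ elementAt y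
    elementAt-* y z z≈xy with y ≈? F.0# | z ≈? F.0#
    ... | yes _   | yes _   = F.sym (F.*-identityˡ F.1#)
    ... | yes y≈0 | no  z≉0 = ⊥-elim (z≉0 (F.trans z≈xy (F.trans (F.*-congˡ y≈0) (F.zeroʳ x))))
    ... | no  y≉0 | yes z≈0 = ⊥-elim (y≉0 (F.trans (F.sym (cancel x⁻¹x≈1 y))
                                (F.trans (F.*-congˡ (F.trans (F.sym z≈xy) z≈0)) (F.zeroʳ x⁻¹))))
    ... | no  _   | no  _   = z≈xy

    product-invariant : sum factor ∙ sum element ≈ sum element
    product-invariant = begin
      sum factor ∙ sum element              ≈⟨ ∑-distrib-+ factor element ⟨
      sum (λ k → factor k ∙ element k)
        ≈⟨ sum-cong-≋ {x = λ k → element (π ⟨$⟩ʳ k)} {y = λ k → factor k ∙ element k}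
             (λ k → elementAt-* (E.from k) _ (from-to (x F.* E.from k))) ⟨
      sum (λ k → element (π ⟨$⟩ʳ k))        ≈⟨ sum-permute element π ⟨
      sum element                           ∎

units-exponent : ∀ {q} (F : FiniteField c ℓ₁ ℓ₂ q) (u : Unit F) →
                 FiniteField._≈_ F (val (u ↑ + (q ∸ 1))) (FiniteField.1# F)
-- The element `0#` would have an index in `Fin 0`, so `q` is a successor and the truncated
-- subtraction is harmless.
units-exponent {q = zero}  F u with () ← Inverse.to (FiniteField.enumeration F) (FiniteField.0# F)
units-exponent {q = suc q} F u = times-exponent F u

-- Linear maps and traces

-- This regards `F` as a vector space over itself, so that coordinates and traces are linear maps in
-- the sense of `Linear`.
id↪ : ∀ {q} (F : FiniteField c ℓ₁ ℓ₂ q) → F ↪ F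
id↪ F = record { ringHomomorphism = Identity.ringHomomorphism (FiniteField.ring F) }

module _ {q r u} {F : FiniteField c ℓ₁ ℓ₂ q} {K : FiniteField c′ ℓ₁′ ℓ₂′ r}
         {L : FiniteField c″ ℓ₁″ ℓ₂″ u} (ι : F ↪ K) (κ : F ↪ L) where
  private
    module F = FiniteField F
    module K = FiniteField K
    module L = FiniteField L
    module ι = _↪_ ι
    module κ = _↪_ κ
    module Kₛ = CommutativeMonoidSum K.+-commutativeMonoid
    module Lₛ = CommutativeMonoidSum L.+-commutativeMonoid

  -- Each embedding of `F` supplies the scalar action on one side. Compatibility with `≈` is a field
  -- because `φ` is a bare function between setoids.
  record Linear (φ : K.Carrier → L.Carrier) : Set (c ⊔ c′ ⊔ ℓ₁′ ⊔ ℓ₁″) where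
    field
      cong    : ∀ {x y} → x K.≈ y → φ x L.≈ φ y
      +-homo  : ∀ x y → φ (x K.+ y) L.≈ φ x L.+ φ y
      *-homo  : ∀ f x → φ (ι.⟦ f ⟧ K.* x) L.≈ κ.⟦ f ⟧ L.* φ x

    0#-homo : φ K.0# L.≈ L.0#
    0#-homo = begin
      φ K.0#                     ≈⟨ cong (K.zeroˡ K.0#) ⟨
      φ (K.0# K.* K.0#)          ≈⟨ cong (K.*-congʳ ι.0#-homo) ⟨
      φ (ι.⟦ F.0# ⟧ K.* K.0#)    ≈⟨ *-homo F.0# K.0# ⟩
      κ.⟦ F.0# ⟧ L.* φ K.0#      ≈⟨ L.*-congʳ κ.0#-homo ⟩
      L.0# L.* φ K.0#            ≈⟨ L.zeroˡ (φ K.0#) ⟩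
      L.0#                       ∎
      where open SetoidReasoning L.setoid

    sum-homo : ∀ {d} (v : Vector K.Carrier d) → φ (Kₛ.sum v) L.≈ Lₛ.sum (λ i → φ (v i))
    sum-homo {zero}  v = 0#-homo
    sum-homo {suc d} v =
      L.trans (+-homo (v Fin.zero) _) (L.+-congˡ (sum-homo (λ i → v (Fin.suc i))))

    lincomb-homo : ∀ {d} (a : Vector F.Carrier d) (v : Vector K.Carrier d) →
                   φ (Extension.lincomb ι a v) L.≈ Extension.lincomb κ a (λ i → φ (v i))
    lincomb-homo {d} a v =
      L.trans (sum-homo {d} (λ i → ι.⟦ a i ⟧ K.* v i)) (Lₛ.sum-cong-≋ {d} λ i → *-homo (a i) (v i))

  sum-linear : ∀ {d} {φ : Fin d → K.Carrier → L.Carrier} → (∀ i → Linear (φ i)) →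
               Linear (λ x → Lₛ.sum (λ i → φ i x))
  sum-linear {d} {φ} φ-linear = record
    { cong   = λ x≈y → Lₛ.sum-cong-≋ {d} λ i → Linear.cong (φ-linear i) x≈y
    ; +-homo = λ x y → L.trans (Lₛ.sum-cong-≋ {d} λ i → Linear.+-homo (φ-linear i) x y)
                               (Lₛ.∑-distrib-+ {d} _ _)
    ; *-homo = λ f x → L.trans (Lₛ.sum-cong-≋ {d} λ i → Linear.*-homo (φ-linear i) f x)
                               (L.sym (SemiringSum.*-distribˡ-sum L.semiring {d} κ.⟦ f ⟧ _))
    }

module _ {q r u w} {F : FiniteField c ℓ₁ ℓ₂ q} {K : FiniteField c′ ℓ₁′ ℓ₂′ r}
         {L : FiniteField c″ ℓ₁″ ℓ₂″ u} {M : FiniteField c‴ ℓ₁‴ ℓ₂‴ w}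
         {ι : F ↪ K} {κ : F ↪ L} {μ : F ↪ M} where
  private module M = FiniteField M

  ∘-linear : ∀ {φ ψ} → Linear κ μ ψ → Linear ι κ φ → Linear ι μ (λ x → ψ (φ x))
  ∘-linear ψ-linear φ-linear = record
    { cong   = λ x≈y → ψ.cong (φ.cong x≈y)
    ; +-homo = λ x y → M.trans (ψ.cong (φ.+-homo x y)) (ψ.+-homo _ _)
    ; *-homo = λ f x → M.trans (ψ.cong (φ.*-homo f x)) (ψ.*-homo f _)
    }
    where
    module φ = Linear φ-linear
    module ψ = Linear ψ-linear

module _ {q r u w} {F : FiniteField c ℓ₁ ℓ₂ q} {K : FiniteField c′ ℓ₁′ ℓ₂′ r}
         {L : FiniteField c″ ℓ₁″ ℓ₂″ u} {M : FiniteField c‴ ℓ₁‴ ℓ₂‴ w}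
         (ι : F ↪ K) {κ : K ↪ L} {μ : K ↪ M} {κ′ : F ↪ L} {μ′ : F ↪ M} where
  private
    module L = FiniteField L
    module M = FiniteField M
    module ι = _↪_ ι
    module κ = _↪_ κ
    module μ = _↪_ μ
    module κ′ = _↪_ κ′
    module μ′ = _↪_ μ′

  -- The new embeddings have only to agree pointwise with the composites; thus `ι` itself can stand
  -- for `id↪ K` after `ι`.
  restrictScalars : (∀ f → κ.⟦ ι.⟦ f ⟧ ⟧ L.≈ κ′.⟦ f ⟧) → (∀ f → μ.⟦ ι.⟦ f ⟧ ⟧ M.≈ μ′.⟦ f ⟧) →
                    ∀ {φ} → Linear κ μ φ → Linear κ′ μ′ φ
  restrictScalars κι≈κ′ μι≈μ′ φ-linear = record
    { cong   = φ.cong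
    ; +-homo = φ.+-homo
    ; *-homo = λ f x → M.trans (φ.cong (L.*-congʳ (L.sym (κι≈κ′ f))))
                         (M.trans (φ.*-homo ι.⟦ f ⟧ x) (M.*-congʳ (μι≈μ′ f)))
    }
    where module φ = Linear φ-linear

-- Coordinates in a basis and traces of endomorphisms

module _ {q r} {F : FiniteField c ℓ₁ ℓ₂ q} {K : FiniteField c′ ℓ₁′ ℓ₂′ r} (ι : F ↪ K) where
  private
    module F = FiniteField F
    module K = FiniteField K
    module ι = _↪_ ι
    module Fₛ = CommutativeMonoidSum F.+-commutativeMonoid
    module Kₛ = CommutativeMonoidSum K.+-commutativeMonoid
    module Kₘ = SemiringSum K.semiring
  open Extension ι using (lincomb; Independent; Basis; traceIn)

  *ʳ-linear : ∀ y → Linear ι ι (K._* y)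
  *ʳ-linear y = record
    { cong   = K.*-congʳ
    ; +-homo = K.distribʳ y
    ; *-homo = λ f x → K.*-assoc ι.⟦ f ⟧ x y
    }

  *ˡ-linear : ∀ x → Linear ι ι (x K.*_)
  *ˡ-linear x = record
    { cong   = K.*-congˡ
    ; +-homo = K.distribˡ x
    ; *-homo = λ f y → x∙yz≈y∙xz x ι.⟦ f ⟧ y
    }
    where open CommutativeSemigroupProperties
                 (CommutativeRing.*-commutativeSemigroup K.commutativeRing)

  ⟦⟧*-linear : ∀ y → Linear (id↪ F) ι (λ f → ι.⟦ f ⟧ K.* y)
  ⟦⟧*-linear y = record
    { cong   = λ f≈g → K.*-congʳ (ι.⟦⟧-cong f≈g)
    ; +-homo = λ f g → K.trans (K.*-congʳ (ι.+-homo f g)) (K.distribʳ y _ _)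
    ; *-homo = λ f g → K.trans (K.*-congʳ (ι.*-homo f g)) (K.*-assoc _ _ y)
    }

  lincomb-cong : ∀ {d} {a b : Vector F.Carrier d} (v : Vector K.Carrier d) →
                 (∀ i → a i F.≈ b i) → lincomb a v K.≈ lincomb b v
  lincomb-cong v a≈b = Kₛ.sum-cong-≋ λ i → Linear.cong (⟦⟧*-linear (v i)) (a≈b i)

  lincomb-+ : ∀ {d} (a b : Vector F.Carrier d) v →
              lincomb (λ i → a i F.+ b i) v K.≈ lincomb a v K.+ lincomb b v
  lincomb-+ {d} a b v =
    K.trans (Kₛ.sum-cong-≋ {d} λ i → Linear.+-homo (⟦⟧*-linear (v i)) (a i) (b i))
            (Kₛ.∑-distrib-+ {d} _ _)

  lincomb-* : ∀ {d} f (a : Vector F.Carrier d) v →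
              lincomb (λ i → f F.* a i) v K.≈ ι.⟦ f ⟧ K.* lincomb a v
  lincomb-* {d} f a v =
    K.trans (Kₛ.sum-cong-≋ {d} λ i → Linear.*-homo (⟦⟧*-linear (v i)) f (a i))
            (K.sym (Kₘ.*-distribˡ-sum {d} ι.⟦ f ⟧ _))

  -- Adding `lincomb b v` to the combination with coefficients `a i F.- b i` gives `lincomb a v`,
  -- hence `lincomb b v` again. The combination of differences is therefore zero, and independence
  -- applies.
  lincomb-injective : ∀ {d} {v : Vector K.Carrier d} → Independent v → ∀ a b →
                      lincomb a v K.≈ lincomb b v → ∀ i → a i F.≈ b i
  lincomb-injective {v = v} independent a b eq i =
    x∙y⁻¹≈ε⇒x≈y (a i) (b i) (independent (λ i → a i F.- b i)
      (identityˡ-unique _ (lincomb b v) (begin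
        lincomb (λ i → a i F.- b i) v K.+ lincomb b v  ≈⟨ lincomb-+ _ b v ⟨
        lincomb (λ i → a i F.- b i F.+ b i) v
          ≈⟨ lincomb-cong v (λ i → //-rightDividesˡ (b i) (a i)) ⟩
        lincomb a v                                    ≈⟨ eq ⟩
        lincomb b v                                    ∎)) i)
    where
    open SetoidReasoning K.setoid
    open GroupProperties F.+-group using (x∙y⁻¹≈ε⇒x≈y; //-rightDividesˡ)
    open GroupProperties K.+-group using (identityˡ-unique)

  module _ (b : Basis) where
    open Basis b

    -- A `Basis` only asks that `coord x` represent `x`. Even compatibility with `≈` has to be
    -- derived: in each case both sides are coefficients of the same vector, and such coefficients
    -- are unique.
    coord-linear : ∀ i → Linear ι (id↪ F) (λ x → coord x i)
    coord-linear i = record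
      { cong   = λ {x} {y} x≈y → unique _ _ (begin
          lincomb (coord x) vec  ≈⟨ spanning x ⟩
          x                      ≈⟨ x≈y ⟩
          y                      ≈⟨ spanning y ⟨
          lincomb (coord y) vec  ∎) i
      ; +-homo = λ x y → unique _ _ (begin
          lincomb (coord (x K.+ y)) vec                    ≈⟨ spanning (x K.+ y) ⟩
          x K.+ y                                          ≈⟨ K.+-cong (spanning x) (spanning y) ⟨
          lincomb (coord x) vec K.+ lincomb (coord y) vec  ≈⟨ lincomb-+ (coord x) (coord y) vec ⟨
          lincomb (λ i → coord x i F.+ coord y i) vec      ∎) i
      ; *-homo = λ f x → unique _ _ (begin
          lincomb (coord (ι.⟦ f ⟧ K.* x)) vec    ≈⟨ spanning (ι.⟦ f ⟧ K.* x) ⟩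
          ι.⟦ f ⟧ K.* x                          ≈⟨ K.*-congˡ (spanning x) ⟨
          ι.⟦ f ⟧ K.* lincomb (coord x) vec      ≈⟨ lincomb-* f (coord x) vec ⟨
          lincomb (λ i → f F.* coord x i) vec    ∎) i
      }
      where
      open SetoidReasoning K.setoid
      unique = lincomb-injective independent

    -- Applied to a coordinate of a linear map, this expresses an entry of a composite as a matrix
    -- product.
    linear-expand : ∀ {φ} → Linear ι (id↪ F) φ → ∀ x →
                    φ x F.≈ Fₛ.sum (λ i → coord x i F.* φ (vec i))
    linear-expand φ-linear x =
      F.trans (F.sym (φ.cong (spanning x))) (φ.lincomb-homo (coord x) vec)
      where module φ = Linear φ-linear

    -- `traceIn` covers multiplication maps only; the cyclic property of the trace needs arbitrary
    -- endomorphisms.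
    traceOf : (K.Carrier → K.Carrier) → F.Carrier
    traceOf T = Fₛ.sum (λ i → coord (T (vec i)) i)

    traceIn-linear : Linear ι (id↪ F) (traceIn b)
    traceIn-linear = sum-linear ι (id↪ F) λ i → ∘-linear (coord-linear i) (*ʳ-linear (vec i))

-- Cyclic property and transitivity of the trace

module _ {q r u} {F : FiniteField c ℓ₁ ℓ₂ q} {K : FiniteField c′ ℓ₁′ ℓ₂′ r}
         {L : FiniteField c″ ℓ₁″ ℓ₂″ u} {ι : F ↪ K} {κ : F ↪ L}
         (b : Extension.Basis ι) (e : Extension.Basis κ) where
  private
    module F = FiniteField F
    module Fₛ = CommutativeMonoidSum F.+-commutativeMonoid
    module B = Extension.Basis b
    module E = Extension.Basis e

  -- Both traces are the double sum of products of an entry of `φ` with an entry of `ψ`, taken in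
  -- the two orders of summation. The two spaces may differ in dimension.
  traceOf-comm : ∀ {φ ψ} → Linear ι κ φ → Linear κ ι ψ →
                 traceOf ι b (λ x → ψ (φ x)) F.≈ traceOf κ e (λ y → φ (ψ y))
  traceOf-comm {φ} {ψ} φ-linear ψ-linear = begin
    Fₛ.sum (λ i → B.coord (ψ (φ (B.vec i))) i)
      ≈⟨ Fₛ.sum-cong-≋ (λ i → linear-expand κ e (∘-linear (coord-linear ι b i) ψ-linear) _) ⟩
    Fₛ.sum (λ i → Fₛ.sum (λ j → E.coord (φ (B.vec i)) j F.* B.coord (ψ (E.vec j)) i))
      ≈⟨ Fₛ.∑-comm {B.dim} {E.dim} _ ⟩
    Fₛ.sum (λ j → Fₛ.sum (λ i → E.coord (φ (B.vec i)) j F.* B.coord (ψ (E.vec j)) i))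
      ≈⟨ Fₛ.sum-cong-≋ {E.dim} (λ j → Fₛ.sum-cong-≋ {B.dim} (λ i → F.*-comm _ _)) ⟩
    Fₛ.sum (λ j → Fₛ.sum (λ i → B.coord (ψ (E.vec j)) i F.* E.coord (φ (B.vec i)) j))
      ≈⟨ Fₛ.sum-cong-≋ (λ j → linear-expand ι b (∘-linear (coord-linear κ e j) φ-linear) _) ⟨
    Fₛ.sum (λ j → E.coord (φ (ψ (E.vec j))) j) ∎
    where open SetoidReasoning F.setoid

module _ {q r u} {F : FiniteField c ℓ₁ ℓ₂ q} {K : FiniteField c′ ℓ₁′ ℓ₂′ r}
         {L : FiniteField c″ ℓ₁″ ℓ₂″ u} (ι : F ↪ K) (κ : K ↪ L)
         (b : Extension.Basis ι) (e : Extension.Basis κ) (h : Extension.Basis (κ ∘↪ ι)) where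
  private
    module F = FiniteField F
    module K = FiniteField K
    module L = FiniteField L
    module κ = _↪_ κ
    module Fₛ = CommutativeMonoidSum F.+-commutativeMonoid
    module B = Extension.Basis b
    module E = Extension.Basis e
    module H = Extension.Basis h
  open Extension using (traceIn)
  open CommutativeSemigroupProperties
    (CommutativeRing.*-commutativeSemigroup L.commutativeRing) using (x∙yz≈y∙xz)

  -- Multiplication by x on L is the sum over a of inject a ∘ project a, so its trace over F is
  -- the sum of the traces of project a ∘ inject a, which is multiplication by the a-th diagonal
  -- entry of the matrix of x over K.
  traceIn-∘ : ∀ x → traceIn (κ ∘↪ ι) h x F.≈ traceIn ι b (traceIn κ e x)
  traceIn-∘ x = begin
    Fₛ.sum (λ k → H.coord (x L.* H.vec k) k)
      -- Here `x L.* H.vec k` is expanded in the basis `e` over `K`, and the coordinate functional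
      -- over `F` is distributed over that sum.
      ≈⟨ Fₛ.sum-cong-≋ (λ k → F.trans
           (F.sym (Linear.cong (coord-linear (κ ∘↪ ι) h k) (E.spanning _)))
           (Linear.sum-homo (coord-linear (κ ∘↪ ι) h k) {E.dim} _)) ⟩
    Fₛ.sum (λ k → Fₛ.sum (λ a → H.coord (inject a (project a (H.vec k))) k))
      ≈⟨ Fₛ.∑-comm {H.dim} {E.dim} _ ⟩
    Fₛ.sum (λ a → traceOf (κ ∘↪ ι) h (λ y → inject a (project a y)))
      ≈⟨ Fₛ.sum-cong-≋ (λ a → traceOf-comm h b (project-linear a) (inject-linear a)) ⟩
    Fₛ.sum (λ a → traceOf ι b (λ y → project a (inject a y)))
      ≈⟨ Fₛ.sum-cong-≋ (λ a → Fₛ.sum-cong-≋ (λ i →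
           Linear.cong (coord-linear ι b i) (project-inject a (B.vec i)))) ⟩
    Fₛ.sum (λ a → traceIn ι b (E.coord (x L.* E.vec a) a))
      ≈⟨ Linear.sum-homo (traceIn-linear ι b) {E.dim} _ ⟨
    traceIn ι b (traceIn κ e x) ∎
    where
    open SetoidReasoning F.setoid

    inject : Fin E.dim → K.Carrier → L.Carrier
    inject a y = κ.⟦ y ⟧ L.* E.vec a

    project : Fin E.dim → L.Carrier → K.Carrier
    project a y = E.coord (x L.* y) a

    inject-linear : ∀ a → Linear ι (κ ∘↪ ι) (inject a)
    inject-linear a = restrictScalars ι (λ _ → K.refl) (λ _ → L.refl) (⟦⟧*-linear κ (E.vec a))

    -- Linearity over `K` lets `project-inject` take the scalar `y` out; `traceOf-comm` is applied
    -- to the restriction to `F`.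
    project-linearᴷ : ∀ a → Linear κ (id↪ K) (project a)
    project-linearᴷ a = ∘-linear (coord-linear κ e a) (*ˡ-linear κ x)

    project-linear : ∀ a → Linear (κ ∘↪ ι) ι (project a)
    project-linear a = restrictScalars ι (λ _ → L.refl) (λ _ → K.refl) (project-linearᴷ a)

    project-inject : ∀ a y → project a (inject a y) K.≈ E.coord (x L.* E.vec a) a K.* y
    project-inject a y = K.trans (Linear.*-homo (project-linearᴷ a) y (E.vec a)) (K.*-comm y _)

tr-linear : ∀ {q r} {F : FiniteField c ℓ₁ ℓ₂ q} {K : FiniteField c′ ℓ₁′ ℓ₂′ r} (ι : F ↪ K) →
            Linear ι (id↪ F) (tr ι)
tr-linear ι = traceIn-linear ι (Extension.basis ι)

-- The basis chosen for the composite extension is not built from those of the two steps, which is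
-- why `traceIn-∘` allows three arbitrary bases.
tr-∘ : ∀ {q r u} {F : FiniteField c ℓ₁ ℓ₂ q} {K : FiniteField c′ ℓ₁′ ℓ₂′ r}
       {L : FiniteField c″ ℓ₁″ ℓ₂″ u} (ι : F ↪ K) (κ : K ↪ L) x →
       FiniteField._≈_ F (tr (κ ∘↪ ι) x) (tr ι (tr κ x))
tr-∘ ι κ = traceIn-∘ ι κ (Extension.basis ι) (Extension.basis κ) (Extension.basis (κ ∘↪ ι))

-- Columns of the trace array

mainTheorem5 :
  ∀ {c ℓ₁ ℓ₂} (p m n : ℕ) (p-prime : Prime p) .{{_ : NonZero m}} .{{_ : NonZero n}} → m ∣ n →
  (𝔽p : FiniteField c ℓ₁ ℓ₂ p) (𝔽pᵐ : FiniteField c ℓ₁ ℓ₂ (p ^ m)) (𝔽pⁿ : FiniteField c ℓ₁ ℓ₂ (p ^ n))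
  (ι : 𝔽p ↪ 𝔽pᵐ) (κ : 𝔽pᵐ ↪ 𝔽pⁿ) →
  let module P = FiniteField 𝔽p
      module M = FiniteField 𝔽pᵐ
      module N = FiniteField 𝔽pⁿ
      open _↪_ κ using (⟦_⟧)
      s = p ^ m ∸ 1
      s≢0 = p^m∸1-nonZero p-prime m
      t = _/_ (p ^ n ∸ 1) s {{s≢0}}
  in
  gcd s t ≡ 1 →
  (α : Unit 𝔽pⁿ) → IsGenerator α →
  (β : Unit 𝔽pᵐ) → ⟦ val β ⟧ N.≈ val (α ↑ + t) →
  let γ = α ↑ + s
      B : Fin s → Fin t → P.Carrier
      B i j = tr (κ ∘↪ ι) (⟦ val (β ↑ + toℕ i) ⟧ N.* val (γ ↑ + toℕ j))
  in
  (j : Fin t) →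
    (tr κ (val (γ ↑ + toℕ j)) M.≈ M.0# → (i : Fin s) → B i j P.≈ P.0#)
  × ((r : ℤ) → tr κ (val (γ ↑ + toℕ j)) M.≈ val (β ↑ r) → (i : Fin s) →
       B i j P.≈ cyclicShift {{s≢0}} r (DB ι s β) i
     × B i j P.≈ tr ι (val (β ↑ (r + + toℕ i))))
mainTheorem5 p m n p-prime _ 𝔽p 𝔽pᵐ 𝔽pⁿ ι κ _ α _ β _ j =
  column-zero , λ r eq i → column-shift r eq i , column-value r eq i
  where
  module P = FiniteField 𝔽p
  module M = FiniteField 𝔽pᵐ
  module N = FiniteField 𝔽pⁿ
  open _↪_ κ using (⟦_⟧)
  open UnitProperties 𝔽pᵐ
  s = p ^ m ∸ 1
  s≢0 = p^m∸1-nonZero p-prime m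
  g = (α ↑ + s) ↑ + toℕ j

  module trι = Linear (tr-linear ι)

  B : Fin s → P.Carrier
  B i = tr (κ ∘↪ ι) (⟦ val (β ↑ + toℕ i) ⟧ N.* val g)

  -- The power of `β` is a scalar for the inner trace, so only `tr κ (val g)` depends on the column.
  entry : ∀ i → B i P.≈ tr ι (val (β ↑ + toℕ i) M.* tr κ (val g))
  entry i = P.trans (tr-∘ ι κ _) (trι.cong (Linear.*-homo (tr-linear κ) _ _))

  column-zero : tr κ (val g) M.≈ M.0# → ∀ i → B i P.≈ P.0#
  column-zero eq i =
    P.trans (entry i) (P.trans (trι.cong (M.trans (M.*-congˡ eq) (M.zeroʳ _))) trι.0#-homo)

  column-value : ∀ r → tr κ (val g) M.≈ val (β ↑ r) → ∀ i →
                 B i P.≈ tr ι (val (β ↑ (r + + toℕ i)))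
  column-value r eq i = P.trans (entry i) (trι.cong (M.trans (M.*-congˡ eq)
    (M.trans (M.*-comm _ _) (M.sym (↑-homo-+ β r (+ toℕ i))))))

  column-shift : ∀ r → tr κ (val g) M.≈ val (β ↑ r) → ∀ i →
                 B i P.≈ cyclicShift {{s≢0}} r (DB ι s β) i
  -- The shifted entry of `DB` has as exponent the remainder of `r + + toℕ i` modulo `s`. As `s` is
  -- one less than the size of the middle field, `units-exponent` permits the return to the
  -- unreduced exponent.
  column-shift r eq i = P.trans (column-value r eq i) (P.sym (trι.cong (M.trans
    (M.reflexive (≡.cong (λ k → val (β ↑ + k)) (toℕ-fromℕ< (n%ℕd<d (r + + toℕ i) s {{s≢0}}))))
    (↑-%ℕ s (units-exponent 𝔽pᵐ) {{s≢0}} β (r + + toℕ i)))))
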